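{- Let $G$ be a finite simple graph that is $\{2K_2, K_5-e\}$-free with $\omega(G)\geq 4$. Then $\chi(G)\leq 6$ if $\omega(G)=4$, and $\chi(G)\leq \omega(G)$ if $\omega(G)\geq 5$.
   Context: $\chi(G)$ is the chromatic number and $\omega(G)$ the clique number of $G$. $2K_2$ is the disjoint union of two edges; $K_5-e$ is the complete graph on five vertices with one edge removed. A graph is $\mathcal{F}$-free if it has no induced subgraph isomorphic to a member of $\mathcal{F}$. -}

module Defs where

open import Data.Nat using (ℕ; zero; suc; _≤_)
open import Data.Nat.Base using (_≡ᵇ_)
open import Data.Fin using (Fin; toℕ)
open import Data.Fin.Properties using (all?)
open import Data.Bool using (Bool; true; false; _∧_; _∨_; not)
open import Data.Bool.Properties using () renaming (_≟_ to _≟ᵇ_)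
open import Data.Product using (Σ; _×_)
open import Data.Unit using (tt)
open import Function.Definitions using (Injective)
open import Relation.Nullary using (¬_)
open import Relation.Nullary.Decidable using (toWitness)
open import Relation.Binary.PropositionalEquality using (_≡_; _≢_)

record Graph : Set where
  field
    n      : ℕ
    adj    : Fin n → Fin n → Bool
    sym    : ∀ u v → adj u v ≡ adj v u
    irrefl : ∀ v → adj v v ≡ false

open Graph public

Adj : (G : Graph) → Fin (n G) → Fin (n G) → Set
Adj G u v = adj G u v ≡ true

InducedSubgraph : Graph → Graph → Set
InducedSubgraph H G =
  Σ (Fin (n H) → Fin (n G)) λ f →
    Injective _≡_ _≡_ f × (∀ u v → adj H u v ≡ adj G (f u) (f v))

Free : Graph → Graph → Set
Free H G = ¬ InducedSubgraph H G

HasClique : Graph → ℕ → Set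
HasClique G k =
  Σ (Fin k → Fin (n G)) λ f →
    Injective _≡_ _≡_ f × (∀ i j → i ≢ j → Adj G (f i) (f j))

CliqueNumber : Graph → ℕ → Set
CliqueNumber G k = HasClique G k × ¬ HasClique G (suc k)

Colorable : Graph → ℕ → Set
Colorable G c =
  Σ (Fin (n G) → Fin c) λ col → ∀ u v → Adj G u v → col u ≢ col v

symAdj : (m : ℕ) → (ℕ → ℕ → Bool) → Fin m → Fin m → Bool
symAdj m e u v = not (toℕ u ≡ᵇ toℕ v) ∧ (e (toℕ u) (toℕ v) ∨ e (toℕ v) (toℕ u))

e2K₂ : ℕ → ℕ → Bool
e2K₂ 0 1 = true
e2K₂ 2 3 = true
e2K₂ _ _ = false

2K₂ : Graph
2K₂ = record
  { n = 4
  ; adj = symAdj 4 e2K₂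
  ; sym = toWitness {a? = all? λ u → all? λ v → symAdj 4 e2K₂ u v ≟ᵇ symAdj 4 e2K₂ v u} tt
  ; irrefl = toWitness {a? = all? λ v → symAdj 4 e2K₂ v v ≟ᵇ false} tt
  }

eK₅-e : ℕ → ℕ → Bool
eK₅-e 0 1 = false
eK₅-e 1 0 = false
eK₅-e _ _ = true

K₅-e : Graph
K₅-e = record
  { n = 5
  ; adj = symAdj 5 eK₅-e
  ; sym = toWitness {a? = all? λ u → all? λ v → symAdj 5 eK₅-e u v ≟ᵇ symAdj 5 eK₅-e v u} tt
  ; irrefl = toWitness {a? = all? λ v → symAdj 5 eK₅-e v v ≟ᵇ false} tt
  }

{-# OPTIONS --safe #-}
-- Fix a maximum clique v₀, …, v_{k-1}.  As G is (K₅-e)-free, a vertex outside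
-- the clique has at most two neighbours in it; as G is 2K₂-free, the outside
-- vertices that miss two given clique vertices form an independent set.  Such
-- a set can share its colour with either of the two clique vertices it misses.
-- For k = 4 an outside vertex misses one of the six pairs of clique vertices,
-- and the six colour classes can absorb v₀, …, v₃.  For k ≥ 5 it misses three
-- of v₀, …, v₄, hence both ends of an edge of the triangle 0 1 2 or of the
-- edge 3 4; these four sets take the colours of v₀, v₁, v₂ and v₃.
module Submission where

open import Defs
open import Data.Bool using (true; false)
open import Data.Bool.Properties using () renaming (_≟_ to _≟ᵇ_)
open import Data.Empty using (⊥; ⊥-elim)
open import Data.Fin using (Fin; zero; suc; _↑ˡ_)
open import Data.Fin.Patterns using (0F; 1F; 2F; 3F; 4F; 5F)
open import Data.Fin.Properties using (_≟_; all?; any?; ¬∀⟶∃¬; ↑ˡ-injective)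
open import Data.Nat using (ℕ; suc; _+_; _≤_; s≤s)
open import Data.Product using (∃; _×_; _,_; proj₁; proj₂)
open import Data.Sum using (_⊎_; inj₁; inj₂)
open import Data.Unit using (tt)
open import Function using (id)
open import Function.Definitions using (Injective)
open import Relation.Nullary using (¬_; yes; no)
open import Relation.Nullary.Decidable using (toWitness; _→-dec_; _⊎-dec_; _×-dec_)
open import Relation.Binary.PropositionalEquality using (_≡_; _≢_; refl; trans; cong; subst) renaming (sym to ≡-sym)

-- Such vertices are twins. A map that preserves both adjacency and non-adjacency can identify only
-- twins, so the injectivity of an embedding of `H` is settled by listing the twins of `H`, a finite
-- check.
SameNeighbours : (H : Graph) → Fin (n H) → Fin (n H) → Set
SameNeighbours H u v = ∀ w → adj H u w ≡ adj H v w

2K₂-twin-free : ∀ u v → SameNeighbours 2K₂ u v → u ≡ v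
2K₂-twin-free = toWitness {a? = all? λ u → all? λ v →
  (all? λ w → adj 2K₂ u w ≟ᵇ adj 2K₂ v w) →-dec (u ≟ v)} tt

-- The ends `0F` and `1F` of the removed edge share the neighbours `2F`, `3F`, `4F`; any other two
-- distinct vertices are adjacent, and adjacent vertices are never twins.
K₅-e-twins : ∀ u v → SameNeighbours K₅-e u v →
             u ≡ v ⊎ (u ≡ 0F × v ≡ 1F) ⊎ (u ≡ 1F × v ≡ 0F)
K₅-e-twins = toWitness {a? = all? λ u → all? λ v →
  (all? λ w → adj K₅-e u w ≟ᵇ adj K₅-e v w) →-dec
  ((u ≟ v) ⊎-dec ((u ≟ 0F) ×-dec (v ≟ 1F)) ⊎-dec ((u ≟ 1F) ×-dec (v ≟ 0F)))} tt

module _ (G : Graph) where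

  private
    V : Set
    V = Fin (n G)

  NonAdj : V → V → Set
  NonAdj u v = adj G u v ≡ false

  Adj-sym : ∀ {u v} → Adj G u v → Adj G v u
  Adj-sym {u} {v} = trans (sym G v u)

  NonAdj-sym : ∀ {u v} → NonAdj u v → NonAdj v u
  NonAdj-sym {u} {v} = trans (sym G v u)

  Adj-NonAdj : ∀ {u v} → Adj G u v → NonAdj u v → ⊥
  Adj-NonAdj p q with () ← trans (≡-sym p) q

  Adj⇒≢ : ∀ {u v} → Adj G u v → u ≢ v
  Adj⇒≢ {u} p refl = Adj-NonAdj p (irrefl G u)

  preimage-SameNeighbours : ∀ H (g : Fin (n H) → V) →
    (∀ u v → adj H u v ≡ adj G (g u) (g v)) →
    ∀ {u v} → g u ≡ g v → SameNeighbours H u v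
  preimage-SameNeighbours H g pres {u} {v} eq w =
    trans (pres u w) (trans (cong (λ z → adj G z (g w)) eq) (≡-sym (pres v w)))

  disjoint-edges⇒2K₂ : ∀ {a b c d} → Adj G a b → Adj G c d →
    NonAdj a c → NonAdj a d → NonAdj b c → NonAdj b d → InducedSubgraph 2K₂ G
  disjoint-edges⇒2K₂ {a} {b} {c} {d} ab cd ac ad bc bd =
    g , (λ eq → 2K₂-twin-free _ _ (preimage-SameNeighbours 2K₂ g pres eq)) , pres
    where
    g : Fin 4 → V
    g 0F = a
    g 1F = b
    g 2F = c
    g 3F = d
    pres : ∀ u v → adj 2K₂ u v ≡ adj G (g u) (g v)
    pres 0F 0F = ≡-sym (irrefl G a)
    pres 0F 1F = ≡-sym ab
    pres 0F 2F = ≡-sym ac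
    pres 0F 3F = ≡-sym ad
    pres 1F 0F = ≡-sym (Adj-sym ab)
    pres 1F 1F = ≡-sym (irrefl G b)
    pres 1F 2F = ≡-sym bc
    pres 1F 3F = ≡-sym bd
    pres 2F 0F = ≡-sym (NonAdj-sym ac)
    pres 2F 1F = ≡-sym (NonAdj-sym bc)
    pres 2F 2F = ≡-sym (irrefl G c)
    pres 2F 3F = ≡-sym cd
    pres 3F 0F = ≡-sym (NonAdj-sym ad)
    pres 3F 1F = ≡-sym (NonAdj-sym bd)
    pres 3F 2F = ≡-sym (Adj-sym cd)
    pres 3F 3F = ≡-sym (irrefl G d)

  -- `NonAdj x y` also holds when `x` and `y` coincide, hence the hypothesis `x ≢ y`: it rules out
  -- the one collapse that `K₅-e-twins` leaves open.
  triangle-with-two-apexes⇒K₅-e : ∀ {x y a b c} → x ≢ y → NonAdj x y →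
    Adj G x a → Adj G x b → Adj G x c → Adj G y a → Adj G y b → Adj G y c →
    Adj G a b → Adj G a c → Adj G b c → InducedSubgraph K₅-e G
  triangle-with-two-apexes⇒K₅-e {x} {y} {a} {b} {c} x≢y xy xa xb xc ya yb yc ab ac bc =
    g , injective , pres
    where
    g : Fin 5 → V
    g 0F = x
    g 1F = y
    g 2F = a
    g 3F = b
    g 4F = c
    pres : ∀ u v → adj K₅-e u v ≡ adj G (g u) (g v)
    pres 0F 0F = ≡-sym (irrefl G x)
    pres 0F 1F = ≡-sym xy
    pres 0F 2F = ≡-sym xa
    pres 0F 3F = ≡-sym xb
    pres 0F 4F = ≡-sym xc
    pres 1F 0F = ≡-sym (NonAdj-sym xy)
    pres 1F 1F = ≡-sym (irrefl G y)
    pres 1F 2F = ≡-sym ya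
    pres 1F 3F = ≡-sym yb
    pres 1F 4F = ≡-sym yc
    pres 2F 0F = ≡-sym (Adj-sym xa)
    pres 2F 1F = ≡-sym (Adj-sym ya)
    pres 2F 2F = ≡-sym (irrefl G a)
    pres 2F 3F = ≡-sym ab
    pres 2F 4F = ≡-sym ac
    pres 3F 0F = ≡-sym (Adj-sym xb)
    pres 3F 1F = ≡-sym (Adj-sym yb)
    pres 3F 2F = ≡-sym (Adj-sym ab)
    pres 3F 3F = ≡-sym (irrefl G b)
    pres 3F 4F = ≡-sym bc
    pres 4F 0F = ≡-sym (Adj-sym xc)
    pres 4F 1F = ≡-sym (Adj-sym yc)
    pres 4F 2F = ≡-sym (Adj-sym ac)
    pres 4F 3F = ≡-sym (Adj-sym bc)
    pres 4F 4F = ≡-sym (irrefl G c)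
    injective : Injective _≡_ _≡_ g
    injective {u} {v} eq with K₅-e-twins u v (preimage-SameNeighbours K₅-e g pres eq)
    ... | inj₁ u≡v                  = u≡v
    ... | inj₂ (inj₁ (refl , refl)) = ⊥-elim (x≢y eq)
    ... | inj₂ (inj₂ (refl , refl)) = ⊥-elim (x≢y (≡-sym eq))

  module _ {k : ℕ} (K : HasClique G k) where

    private
      f : Fin k → V
      f = proj₁ K

      f-inj : Injective _≡_ _≡_ f
      f-inj = proj₁ (proj₂ K)

      f-adj : ∀ i j → i ≢ j → Adj G (f i) (f j)
      f-adj = proj₂ (proj₂ K)

    Outside : V → Set
    Outside x = ¬ ∃ λ i → f i ≡ x

    MissesPair : V → Fin k × Fin k → Set
    MissesPair x (s , t) = NonAdj x (f s) × NonAdj x (f t)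

    clique-extend : ∀ x → (∀ i → Adj G x (f i)) → HasClique G (suc k)
    clique-extend x xf = g , g-inj , g-adj
      where
      g : Fin (suc k) → V
      g zero    = x
      g (suc i) = f i
      g-inj : Injective _≡_ _≡_ g
      g-inj {zero}  {zero}  _  = refl
      g-inj {zero}  {suc j} eq = ⊥-elim (Adj⇒≢ (xf j) eq)
      g-inj {suc i} {zero}  eq = ⊥-elim (Adj⇒≢ (xf i) (≡-sym eq))
      g-inj {suc i} {suc j} eq = cong suc (f-inj eq)
      g-adj : ∀ i j → i ≢ j → Adj G (g i) (g j)
      g-adj zero    zero    i≢j = ⊥-elim (i≢j refl)
      g-adj zero    (suc j) _   = xf j
      g-adj (suc i) zero    _   = Adj-sym (xf i)
      g-adj (suc i) (suc j) i≢j = f-adj i j (λ eq → i≢j (cong suc eq))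

    -- If `x` saw the whole clique, it would extend it. So `x` misses some `f j`, and `x` and `f j`
    -- are then the two apexes over the triangle `f a`, `f b`, `f c`.
    outside-no-three-neighbours : ¬ HasClique G (suc k) → Free K₅-e G →
      ∀ {x} → Outside x → ∀ {a b c} → a ≢ b → a ≢ c → b ≢ c →
      Adj G x (f a) → Adj G x (f b) → Adj G x (f c) → ⊥
    outside-no-three-neighbours maximum free {x} out {a} {b} {c} a≢b a≢c b≢c xa xb xc
      with all? (λ i → adj G x (f i) ≟ᵇ true)
    ... | yes xf = maximum (clique-extend x xf)
    ... | no ¬xf = free (triangle-with-two-apexes⇒K₅-e (λ eq → out (j , ≡-sym eq)) xj
                     xa xb xc (f-adj j a (j≢ xa)) (f-adj j b (j≢ xb)) (f-adj j c (j≢ xc))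
                     (f-adj a b a≢b) (f-adj a c a≢c) (f-adj b c b≢c))
      where
      missed : ∃ λ j → NonAdj x (f j)
      missed with j , ¬xj ← ¬∀⟶∃¬ k _ (λ i → adj G x (f i) ≟ᵇ true) ¬xf
             with adj G x (f j) in eq
      ... | true  = ⊥-elim (¬xj refl)
      ... | false = j , eq
      j : Fin k
      j = proj₁ missed
      xj : NonAdj x (f j)
      xj = proj₂ missed
      j≢ : ∀ {i} → Adj G x (f i) → j ≢ i
      j≢ xi refl = Adj-NonAdj xi xj

    -- ι colours the clique; γ p colours the outside vertices assigned to the
    -- pair P p, of which only the first member may have the same colour.
    colour-by-missed-pairs : Free 2K₂ G →
      ∀ {m q} (ι : Fin k → Fin m) (γ : Fin q → Fin m) (P : Fin q → Fin k × Fin k) →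
      Injective _≡_ _≡_ ι → Injective _≡_ _≡_ γ →
      (∀ p → proj₁ (P p) ≢ proj₂ (P p)) →
      (∀ p i → γ p ≡ ι i → proj₁ (P p) ≡ i) →
      (∀ x → Outside x → ∃ λ p → MissesPair x (P p)) →
      Colorable G m
    colour-by-missed-pairs free {m} ι γ P ι-inj γ-inj P-distinct γ≡ι pick =
      (λ x → proj₁ (label x)) ,
      (λ x y → proper (proj₂ (label x)) (proj₂ (label y)))
      where
      -- The colour is an index, so each label carries the reason for its colour and `proper` can
      -- argue by cases on these reasons.
      data Label (x : V) : Fin m → Set where
        member  : ∀ i → f i ≡ x → Label x (ι i)
        outside : ∀ p → MissesPair x (P p) → Label x (γ p)

      label : ∀ x → ∃ (Label x)
      label x with any? (λ i → f i ≟ x)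
      ... | yes (i , eq) = ι i , member i eq
      ... | no out with p , miss ← pick x out = γ p , outside p miss

      -- By `γ≡ι`, a clique vertex that shares the colour of pair `p` is the first member of `P p`,
      -- which `x` misses.
      misses : ∀ {x} p i → MissesPair x (P p) → γ p ≡ ι i → NonAdj x (f i)
      misses {x} p i (xs , _) eq = subst (λ z → NonAdj x (f z)) (γ≡ι p i eq) xs

      proper : ∀ {x y a b} → Label x a → Label y b → Adj G x y → a ≢ b
      proper (member i refl) (member j refl) xy eq = Adj⇒≢ xy (cong f (ι-inj eq))
      proper (member i refl) (outside p miss) xy eq =
        Adj-NonAdj (Adj-sym xy) (misses p i miss (≡-sym eq))
      proper (outside p miss) (member i refl) xy eq = Adj-NonAdj xy (misses p i miss eq)
      -- Equal colours mean equal pairs, as `γ` is injective. The edge `x y` and the clique edge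
      -- spanned by that pair would then induce a `2K₂`.
      proper (outside p (xs , xt)) (outside p′ miss′) xy eq with refl ← γ-inj eq =
        free (disjoint-edges⇒2K₂ xy (f-adj _ _ (P-distinct p)) xs xt (proj₁ miss′) (proj₂ miss′))

-- The first four pairs go round the 4-cycle 0 1 2 3, oriented so that pair `p` begins with clique
-- vertex `p`, whose colour it may share. The two diagonals get colours 4 and 5, which no clique
-- vertex uses.
pairs-of-four : Fin 6 → Fin 4 × Fin 4
pairs-of-four 0F = 0F , 1F
pairs-of-four 1F = 1F , 2F
pairs-of-four 2F = 2F , 3F
pairs-of-four 3F = 3F , 0F
pairs-of-four 4F = 0F , 2F
pairs-of-four 5F = 1F , 3F

colorable-ω≡4 : (G : Graph) → CliqueNumber G 4 → Free 2K₂ G → Free K₅-e G → Colorable G 6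
colorable-ω≡4 G (K@(f , _) , maximum) 2K₂-free K₅-e-free =
  colour-by-missed-pairs G K 2K₂-free (_↑ˡ 2) id pairs-of-four
    (↑ˡ-injective 2 _ _) id
    (λ { 0F () ; 1F () ; 2F () ; 3F () ; 4F () ; 5F () })
    (toWitness {a? = all? λ p → all? λ i →
      (p ≟ i ↑ˡ 2) →-dec (proj₁ (pairs-of-four p) ≟ i)} tt)
    pick
  where
  pick : ∀ x → Outside G K x → ∃ λ p → MissesPair G K x (pairs-of-four p)
  pick x out
    with adj G x (f 0F) in e₀ | adj G x (f 1F) in e₁
       | adj G x (f 2F) in e₂ | adj G x (f 3F) in e₃
  ... | false | false | _     | _     = 0F , e₀ , e₁
  ... | _     | false | false | _     = 1F , e₁ , e₂
  ... | _     | _     | false | false = 2F , e₂ , e₃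
  ... | false | _     | _     | false = 3F , e₃ , e₀
  ... | false | _     | false | _     = 4F , e₀ , e₂
  ... | _     | false | _     | false = 5F , e₁ , e₃
  -- With no pair missed, at most one of the four values is `false`, so one of the four triples is
  -- all `true`.
  ... | true  | true  | true  | _     = ⊥-elim (outside-no-three-neighbours G K
    maximum K₅-e-free out (λ ()) (λ ()) (λ ()) e₀ e₁ e₂)
  ... | true  | true  | _     | true  = ⊥-elim (outside-no-three-neighbours G K
    maximum K₅-e-free out (λ ()) (λ ()) (λ ()) e₀ e₁ e₃)
  ... | true  | _     | true  | true  = ⊥-elim (outside-no-three-neighbours G K
    maximum K₅-e-free out (λ ()) (λ ()) (λ ()) e₀ e₂ e₃)
  ... | _     | true  | true  | true  = ⊥-elim (outside-no-three-neighbours G K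
    maximum K₅-e-free out (λ ()) (λ ()) (λ ()) e₁ e₂ e₃)

-- The triangle is oriented cyclically, which makes the first members 0, 1, 2, 3 distinct: pair `p`
-- shares the colour of clique vertex `p`.
triangle-and-edge : ∀ {k} → Fin 4 → Fin (5 + k) × Fin (5 + k)
triangle-and-edge 0F = 0F , 1F
triangle-and-edge 1F = 1F , 2F
triangle-and-edge 2F = 2F , 0F
triangle-and-edge 3F = 3F , 4F

colorable-ω≥5 : (G : Graph) → ∀ {k} → CliqueNumber G (5 + k) →
                Free 2K₂ G → Free K₅-e G → Colorable G (5 + k)
colorable-ω≥5 G {k} (K@(f , _) , maximum) 2K₂-free K₅-e-free =
  -- `_↑ˡ suc k` lands in `Fin (4 + suc k)`, which is `Fin (5 + k)` by computation.
  colour-by-missed-pairs G K 2K₂-free id (_↑ˡ suc k) triangle-and-edge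
    id (↑ˡ-injective (suc k) _ _)
    (λ { 0F () ; 1F () ; 2F () ; 3F () })
    (λ { 0F _ eq → eq ; 1F _ eq → eq ; 2F _ eq → eq ; 3F _ eq → eq })
    pick
  where
  three : ∀ {x} → Outside G K x → ∀ {a b c} → a ≢ b → a ≢ c → b ≢ c →
          Adj G x (f a) → Adj G x (f b) → Adj G x (f c) → ⊥
  three = outside-no-three-neighbours G K maximum K₅-e-free

  pick : ∀ x → Outside G K x → ∃ λ p → MissesPair G K x (triangle-and-edge p)
  pick x out
    with adj G x (f 0F) in e₀ | adj G x (f 1F) in e₁ | adj G x (f 2F) in e₂
       | adj G x (f 3F) in e₃ | adj G x (f 4F) in e₄
  ... | false | false | _     | _     | _     = 0F , e₀ , e₁
  ... | _     | false | false | _     | _     = 1F , e₁ , e₂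
  ... | false | _     | false | _     | _     = 2F , e₂ , e₀
  ... | _     | _     | _     | false | false = 3F , e₃ , e₄
  -- Now `x` sees at least two of 0, 1, 2 and at least one of 3, 4. The three choices of two and the
  -- two choices of one give six cases, each with three neighbours in the clique.
  ... | true  | true  | _     | true  | _     = ⊥-elim (three out (λ ()) (λ ()) (λ ()) e₀ e₁ e₃)
  ... | true  | true  | _     | _     | true  = ⊥-elim (three out (λ ()) (λ ()) (λ ()) e₀ e₁ e₄)
  ... | true  | _     | true  | true  | _     = ⊥-elim (three out (λ ()) (λ ()) (λ ()) e₀ e₂ e₃)
  ... | true  | _     | true  | _     | true  = ⊥-elim (three out (λ ()) (λ ()) (λ ()) e₀ e₂ e₄)
  ... | _     | true  | true  | true  | _     = ⊥-elim (three out (λ ()) (λ ()) (λ ()) e₁ e₂ e₃)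
  ... | _     | true  | true  | _     | true  = ⊥-elim (three out (λ ()) (λ ()) (λ ()) e₁ e₂ e₄)

theorem2p8 : (G : Graph) → (k : ℕ) → CliqueNumber G k → 4 ≤ k
    → Free 2K₂ G → Free K₅-e G
    → (k ≡ 4 → Colorable G 6) × (5 ≤ k → Colorable G k)
theorem2p8 G k ω≡k _ 2K₂-free K₅-e-free =
  (λ { refl → colorable-ω≡4 G ω≡k 2K₂-free K₅-e-free }) ,
  (λ { (s≤s (s≤s (s≤s (s≤s (s≤s _))))) → colorable-ω≥5 G ω≡k 2K₂-free K₅-e-free })
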